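{- Let $f=1+2x_1+2^2x_2+\dots+2^nx_n$ (a linear polynomial over $\mathbb{Q}$, the coefficient of $x_i$ being $2^i$). Then every $\mathrm{Res}(\mathrm{lin}_{\mathbb{Q}})$ refutation of the single linear clause $f=0$ has size $2^{\Omega(n)}$.
   Context: A linear form (linear polynomial) over a ring $R$ is an expression $\sum_i a_ix_i+b$ with $a_i,b\in R$. A linear clause over $R$ is a disjunction $(f_1=0)\vee\dots\vee(f_k=0)$ of linear equations (duplicate disjuncts identified); the empty clause stands for false. Variables range over $\{0,1\}$. The proof system $\mathrm{Res}(\mathrm{lin}_R)$ has the boolean axioms $x=0\vee x=1$ for every variable $x$ and the rules: resolution (from $C\vee f=0$ and $D\vee g=0$ derive $C\vee D\vee(\alpha f+\beta g=0)$ for any $\alpha,\beta\in R$), simplification (from $C\vee a=0$ with $a\in R\setminus\{0\}$ a constant derive $C$), and weakening (from $C$ derive $C\vee f=0$ for any linear form $f$). A derivation of $D$ from a set $\phi$ of linear clauses is a sequence of linear clauses ending in $D$, each of which is in $\phi$, a boolean axiom, or obtained from earlier clauses by a rule; a refutation of $\phi$ is a derivation of the empty clause from $\phi$. The size of a derivation is the total number of occurrences of variables in its clauses plus the total bit-size of all coefficients occurring in it. -}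

module Defs where

open import Data.Nat as ℕ using (ℕ; zero; suc; _^_)
open import Data.Nat.Logarithm using (⌊log₂_⌋)
open import Data.Integer as ℤ using (+_)
open import Data.Rational as ℚ using (ℚ; 0ℚ; 1ℚ; ↥_; ↧ₙ_; _/_)
open import Data.Rational.Properties using (_≟_)
open import Data.List using (List; []; _∷_; _++_; map; upTo)
open import Data.List.Relation.Unary.Any using (Any)
open import Data.List.Membership.Propositional using (_∈_)
open import Data.Product using (Σ; ∃; _×_; _,_)
open import Data.Sum using (_⊎_)
open import Relation.Binary.PropositionalEquality using (_≡_)
open import Relation.Nullary using (¬_; yes; no)

-- Linear forms over ℚ.
-- Variables are x₁, x₂, x₃, … (indexed by positive naturals).
-- A linear form  a₁x₁ + … + aₘxₘ + b  is represented by its constant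
-- term b and the list [a₁, …, aₘ]; coefficients of variables beyond the
-- end of the list are 0.  Two representations denote the same linear
-- form iff they have the same constant and the same coefficients
-- (relation _≈ᶠ_ below), i.e. trailing zeros are irrelevant.

record LinForm : Set where
  constructor lin
  field
    const  : ℚ
    coeffs : List ℚ
open LinForm public

-- coefficient of variable x_{i+1}
coeff : List ℚ → ℕ → ℚ
coeff []       _       = 0ℚ
coeff (a ∷ as) zero    = a
coeff (a ∷ as) (suc i) = coeff as i

_≈ᶠ_ : LinForm → LinForm → Set
f ≈ᶠ g = (const f ≡ const g) × (∀ i → coeff (coeffs f) i ≡ coeff (coeffs g) i)

lincomb : ℚ → ℚ → List ℚ → List ℚ → List ℚ
lincomb α β []       []       = []
lincomb α β (a ∷ as) []       = (α ℚ.* a) ∷ lincomb α β as []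
lincomb α β []       (b ∷ bs) = (β ℚ.* b) ∷ lincomb α β [] bs
lincomb α β (a ∷ as) (b ∷ bs) = (α ℚ.* a ℚ.+ β ℚ.* b) ∷ lincomb α β as bs

combine : ℚ → ℚ → LinForm → LinForm → LinForm
combine α β f g = lin (α ℚ.* const f ℚ.+ β ℚ.* const g) (lincomb α β (coeffs f) (coeffs g))

NonzeroConstant : LinForm → Set
NonzeroConstant f = (∀ i → coeff (coeffs f) i ≡ 0ℚ) × ¬ (const f ≡ 0ℚ)

varForm : ℕ → LinForm
varForm i = lin 0ℚ (go i)
  where
  go : ℕ → List ℚ
  go zero    = 1ℚ ∷ []
  go (suc k) = 0ℚ ∷ go k

varMinusOne : ℕ → LinForm
varMinusOne i = lin (ℚ.- 1ℚ) (coeffs (varForm i))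

-- Linear clauses: a disjunction (f₁ = 0) ∨ … ∨ (f_k = 0), represented by
-- the list [f₁, …, f_k].  Clauses are compared as *sets* of linear forms
-- (order and duplicate disjuncts are irrelevant), with linear forms
-- compared up to _≈ᶠ_.  The empty list is the empty clause.

Clause : Set
Clause = List LinForm

_∈ᶠ_ : LinForm → Clause → Set
f ∈ᶠ C = Any (f ≈ᶠ_) C

_≈ᶜ_ : Clause → Clause → Set
C ≈ᶜ D = ∀ f → ((f ∈ᶠ C → f ∈ᶠ D) × (f ∈ᶠ D → f ∈ᶠ C))

boolAxiom : ℕ → Clause
boolAxiom i = varForm i ∷ varMinusOne i ∷ []

data Justified (φ : List Clause) (Γ : List Clause) (C : Clause) : Set where
  hyp : ∀ {A} → A ∈ φ → C ≈ᶜ A → Justified φ Γ C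
  bool : ∀ i → C ≈ᶜ boolAxiom i → Justified φ Γ C
  resolution : ∀ {E₁ E₂} (f g : LinForm) (C₁ C₂ : Clause) (α β : ℚ) →
    E₁ ∈ Γ → E₂ ∈ Γ → (f ∷ C₁) ≈ᶜ E₁ → (g ∷ C₂) ≈ᶜ E₂ →
    C ≈ᶜ (combine α β f g ∷ (C₁ ++ C₂)) → Justified φ Γ C
  simplification : ∀ {E} (a : LinForm) (C' : Clause) →
    E ∈ Γ → NonzeroConstant a → (a ∷ C') ≈ᶜ E → C ≈ᶜ C' → Justified φ Γ C
  weakening : ∀ {E} (g : LinForm) → E ∈ Γ → C ≈ᶜ (g ∷ E) → Justified φ Γ C

-- Derivation φ Γ : Γ is the sequence of clauses of a derivation from φ,
-- listed in REVERSE order (the head of Γ is the last clause).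
data Derivation (φ : List Clause) : List Clause → Set where
  []  : Derivation φ []
  _▷_ : ∀ {Γ C} → Derivation φ Γ → Justified φ Γ C → Derivation φ (C ∷ Γ)

Refutation : List Clause → List Clause → Set
Refutation φ Γ = Derivation φ ([] ∷ Γ)

bitLen : ℕ → ℕ
bitLen zero    = zero
bitLen (suc m) = suc ⌊log₂ (suc m) ⌋

bitsℚ : ℚ → ℕ
bitsℚ q = bitLen ℤ.∣ ↥ q ∣ ℕ.+ bitLen (↧ₙ q)

-- contribution of a coefficient of a variable: 0 if it is 0 (the variable
-- does not occur), otherwise 1 (one occurrence) plus its bit-size
coeffSize : ℚ → ℕ
coeffSize a with a ≟ 0ℚ
... | yes _ = 0
... | no  _ = suc (bitsℚ a)

constSize : ℚ → ℕ
constSize b with b ≟ 0ℚ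
... | yes _ = 0
... | no  _ = bitsℚ b

sumℕ : List ℕ → ℕ
sumℕ []       = 0
sumℕ (x ∷ xs) = x ℕ.+ sumℕ xs

formSize : LinForm → ℕ
formSize f = constSize (const f) ℕ.+ sumℕ (map coeffSize (coeffs f))

clauseSize : Clause → ℕ
clauseSize C = sumℕ (map formSize C)

derivationSize : List Clause → ℕ
derivationSize Γ = sumℕ (map clauseSize Γ)

fₙ : ℕ → LinForm
fₙ n = lin 1ℚ (map (λ i → (+ (2 ^ suc i)) / 1) (upTo n))

φₙ : ℕ → List Clause
φₙ n = (fₙ n ∷ []) ∷ []

{-# OPTIONS --safe #-}

-- Work on the points x of the cube {0,1}^n, where f = fₙ is injective and
-- nowhere zero.  For a form g and a scalar β let A(g,β) be the set of points
-- with g = β f.  If β ≠ γ then |A(g,β)| |A(g,γ)| ≤ 3^n: addition of vectors is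
-- injective on A(g,β) × A(g,γ), since the sum x + y determines f(x) + f(y) and
-- β f(x) + γ f(y), hence x and y, and its values lie in {0,1,2}^n.  So for
-- each g at most one β, called ratio g, has |A(g,β)| > √(3^n); if there is
-- none, put ratio g = 0.
--
-- Say that a clause holds at x if g(x) = ratio g · f(x) for some disjunct g.
-- The clause f = 0 holds everywhere (the ratio of f is 1), so do the boolean
-- axioms (ratio 0), and a nonzero constant (ratio 0) never does.  Hence every
-- rule preserves "holds at x", except that a resolution step may lose the
-- points of one set A(h,δ) with δ ≠ ratio h, at most √(3^n) of them.  The
-- empty clause holds nowhere, so a refutation of size S must lose all 2^n
-- points, and 2^n ≤ S √(3^n).
module Submission where

open import Defs
open import Data.Nat using (ℕ; zero; suc; _^_; _≤_; _<_; z≤n; s≤s)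
import Data.Nat as ℕ
import Data.Nat.Properties as ℕ
open import Data.Nat.Solver using (module +-*-Solver)
import Data.Integer as ℤ
open import Data.Rational as ℚ using (ℚ; 0ℚ; 1ℚ; _+_; _*_; -_; _-_; _/_)
import Data.Rational.Properties as ℚ
open import Algebra.Properties.Group ℚ.+-0-group
  using (x∙y⁻¹≈ε⇒x≈y) renaming (∙-cancelˡ to +-cancelˡ)
import Data.Rational.Solver as ℚ
import Data.Rational.Unnormalised as ℚᵘ
import Data.Rational.Unnormalised.Properties as ℚᵘ
open import Data.List as List
  using (List; _∷_; []; _++_; length; map; filter; cartesianProduct; cartesianProductWith; applyUpTo)
import Data.List.Properties as List
open import Data.List.Membership.Propositional using (_∈_; find)
open import Data.List.Membership.Propositional.Properties
  using (∈-∃++; ∈-++⁺ˡ; ∈-++⁺ʳ; ∈-++⁻; ∈-filter⁺; ∈-filter⁻;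
         ∈-cartesianProductWith⁺; ∈-cartesianProductWith⁻; ∈-cartesianProduct⁻)
open import Data.List.Relation.Unary.All as All using (All; []; _∷_)
open import Data.List.Relation.Unary.Any as Any using (Any; here; there)
import Data.List.Relation.Unary.Any.Properties as Any
open import Data.List.Relation.Unary.AllPairs using ([]; _∷_)
open import Data.List.Relation.Unary.Unique.Propositional using (Unique)
import Data.List.Relation.Unary.Unique.Propositional.Properties as Unique
open import Data.Vec using (Vec; []; _∷_; zipWith)
open import Data.Vec.Properties using (∷-injective)
open import Data.Product using (∃; ∃-syntax; _×_; _,_; proj₁; proj₂; uncurry)
open import Data.Product.Properties using (×-≡,≡→≡)
open import Data.Sum using (_⊎_; inj₁; inj₂; [_,_]′; map₂)
open import Data.Empty using (⊥-elim)
open import Function using (_∘_; id)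
open import Level using (Level)
open import Relation.Nullary using (¬_; ¬?; Dec; yes; no; contradiction)
open import Relation.Binary.PropositionalEquality

private variable
  a b c : Level
  A : Set a
  B : Set b
  C : Set c

-- Counting

-- Pigeonhole by deletion: the image of the head is cut out of `ys`. By uniqueness and injectivity
-- the images of the other elements survive in what is left.
length-injective-on : {xs : List A} {ys : List B} (f : A → B) →
  Unique xs → (∀ {x y} → x ∈ xs → y ∈ xs → f x ≡ f y → x ≡ y) →
  (∀ {x} → x ∈ xs → f x ∈ ys) → length xs ≤ length ys
length-injective-on {xs = []} f _ _ _ = z≤n
length-injective-on {xs = x ∷ xs} f (x∉xs ∷ uniq) inj into with ∈-∃++ (into (here refl))
... | ys , zs , refl = subst (suc (length xs) ≤_) (sym len)
  (s≤s (length-injective-on f uniq (λ p q → inj (there p) (there q)) into′))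
  where
  len : length (ys ++ f x ∷ zs) ≡ suc (length (ys ++ zs))
  len = trans (List.length-++ ys) (trans (ℕ.+-suc (length ys) (length zs)) (cong suc (sym (List.length-++ ys))))
  into′ : ∀ {y} → y ∈ xs → f y ∈ ys ++ zs
  into′ {y} y∈xs with ∈-++⁻ ys (into (there y∈xs))
  ... | inj₁ p = ∈-++⁺ˡ p
  ... | inj₂ (there p) = ∈-++⁺ʳ ys p
  ... | inj₂ (here fy≡fx) =
    contradiction (inj (here refl) (there y∈xs) (sym fy≡fx)) (All.lookup x∉xs y∈xs)

length-⊆ : {xs ys : List A} → Unique xs → (∀ {x} → x ∈ xs → x ∈ ys) → length xs ≤ length ys
length-⊆ uniq = length-injective-on id uniq (λ _ _ → id)

length-≤1 : {xs : List A} → Unique xs → (∀ {x y} → x ∈ xs → y ∈ xs → x ≡ y) → length xs ≤ 1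
length-≤1 {xs = []} _ _ = z≤n
length-≤1 {xs = x ∷ xs} uniq same = length-⊆ {ys = x ∷ []} uniq (λ p → here (same p (here refl)))

length-cartesianProductWith : (f : A → B → C) (xs : List A) (ys : List B) →
  length (cartesianProductWith f xs ys) ≡ length xs ℕ.* length ys
length-cartesianProductWith f [] ys = refl
length-cartesianProductWith f (x ∷ xs) ys =
  trans (List.length-++ (map (f x) ys))
    (cong₂ ℕ._+_ (List.length-map (f x) ys) (length-cartesianProductWith f xs ys))

-- The alphabet is a parameter because two cubes are counted: {0,1}^n, and {0,1,2}^n for the sums of
-- two of its points.
words : List A → (n : ℕ) → List (Vec A n)
words as zero    = [] ∷ []
words as (suc n) = cartesianProductWith _∷_ as (words as n)

length-words : (as : List A) (n : ℕ) → length (words as n) ≡ length as ^ n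
length-words as zero    = refl
length-words as (suc n) =
  trans (length-cartesianProductWith _∷_ as (words as n)) (cong (length as ℕ.*_) (length-words as n))

words-unique : {as : List A} → Unique as → ∀ n → Unique (words as n)
words-unique uniq zero    = [] ∷ []
words-unique uniq (suc n) = Unique.cartesianProductWith⁺ _∷_ ∷-injective uniq (words-unique uniq n)

∈-words⁻ : ∀ {as : List A} {n x} {xs : Vec A n} → x ∷ xs ∈ words as (suc n) → x ∈ as × xs ∈ words as n
∈-words⁻ {as = as} {n} p with ∈-cartesianProductWith⁻ _∷_ as (words as n) p
... | _ , _ , q , r , refl = q , r

zipWith-words : ∀ {as : List A} {bs : List B} {cs : List C} {f : A → B → C} →
  (∀ {x y} → x ∈ as → y ∈ bs → f x y ∈ cs) →
  ∀ {n} {xs : Vec A n} {ys : Vec B n} → xs ∈ words as n → ys ∈ words bs n →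
  zipWith f xs ys ∈ words cs n
zipWith-words h {xs = []} {[]} _ _ = here refl
zipWith-words h {xs = x ∷ xs} {y ∷ ys} p q =
  ∈-cartesianProductWith⁺ _∷_ (h (proj₁ (∈-words⁻ p)) (proj₁ (∈-words⁻ q)))
    (zipWith-words h (proj₂ (∈-words⁻ p)) (proj₂ (∈-words⁻ q)))

nonempty : {xs : List A} → 0 < length xs → ∃[ x ] x ∈ xs
nonempty {xs = x ∷ xs} _ = x , here refl

^-distribʳ-* : ∀ n a b → (a ℕ.* b) ^ n ≡ a ^ n ℕ.* b ^ n
^-distribʳ-* zero    a b = refl
^-distribʳ-* (suc n) a b =
  trans (cong (a ℕ.* b ℕ.*_) (^-distribʳ-* n a b)) (ℕ.[m*n]*[o*p]≡[m*o]*[n*p] a b (a ^ n) (b ^ n))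

-- An integer stand-in for √(3^n). The lower bound enters the final estimate; the upper one forbids
-- two sets of more than `m` points whose sizes multiply to at most 3^n.
∃-sqrt : ∀ N → ∃[ m ] (m ℕ.* m ≤ N × N < suc m ℕ.* suc m)
∃-sqrt zero = 0 , z≤n , s≤s z≤n
∃-sqrt (suc N) with ∃-sqrt N
... | m , lo , hi with suc m ℕ.* suc m ℕ.≤? suc N
... | yes p = suc m , p , ℕ.≤-<-trans hi (ℕ.*-mono-< (ℕ.n<1+n (suc m)) (ℕ.n<1+n (suc m)))
... | no ¬p = m , ℕ.m≤n⇒m≤1+n lo , ℕ.≰⇒> ¬p

-- Rational arithmetic

*-cancelʳ : ∀ {p q} r → r ≢ 0ℚ → p * r ≡ q * r → p ≡ q
*-cancelʳ {p} {q} r r≢0 eq = trans (expand p) (trans (cong (_* ℚ.1/ r) eq) (sym (expand q)))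
  where
  instance _ = ℚ.≢-nonZero r≢0
  expand : ∀ s → s ≡ s * r * ℚ.1/ r
  expand s = sym (trans (ℚ.*-assoc s r (ℚ.1/ r)) (trans (cong (s *_) (ℚ.*-inverseʳ r)) (ℚ.*-identityʳ s)))

-- A linear system in F - F′ and G - G′ with determinant β - γ: eliminating the second unknown
-- leaves β(F - F′) = γ(F - F′).
two-weight-cancel : ∀ {β γ F G F′ G′} → β ≢ γ → β * F + γ * G ≡ β * F′ + γ * G′ → F + G ≡ F′ + G′ → F ≡ F′
two-weight-cancel {β} {γ} {F} {G} {F′} {G′} β≢γ eq₁ eq₂ with F - F′ ℚ.≟ 0ℚ
... | yes d≡0 = x∙y⁻¹≈ε⇒x≈y F F′ d≡0
... | no  d≢0 = contradiction (*-cancelʳ (F - F′) d≢0 (begin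
  β * (F - F′)                                  ≡⟨ solve 6 (λ β γ F G F′ G′ → β :* (F :- F′)
                                                     := β :* F :+ γ :* G :- β :* F′ :- γ :* G) refl β γ F G F′ G′ ⟩
  β * F + γ * G - β * F′ - γ * G                ≡⟨ cong (λ z → z - β * F′ - γ * G) eq₁ ⟩
  β * F′ + γ * G′ - β * F′ - γ * G              ≡⟨ solve 5 (λ β γ G F′ G′ → β :* F′ :+ γ :* G′ :- β :* F′ :- γ :* G
                                                     := γ :* (F′ :+ G′ :- G :- F′)) refl β γ G F′ G′ ⟩
  γ * (F′ + G′ - G - F′)                        ≡⟨ cong (λ z → γ * (z - G - F′)) eq₂ ⟨
  γ * (F + G - G - F′)                          ≡⟨ solve 4 (λ γ F G F′ → γ :* (F :+ G :- G :- F′) := γ :* (F :- F′)) refl γ F G F′ ⟩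
  γ * (F - F′)                                  ∎)) β≢γ
  where
  open ≡-Reasoning
  open ℚ.+-*-Solver

/1-homo-+ : ∀ i j → (i ℤ.+ j) / 1 ≡ i / 1 + j / 1
/1-homo-+ i j = ℚ.toℚᵘ-injective (begin
  ℚ.toℚᵘ ((i ℤ.+ j) / 1)                 ≈⟨ ℚ.toℚᵘ-fromℚᵘ (ℚᵘ.mkℚᵘ (i ℤ.+ j) 0) ⟩
  ℚᵘ.mkℚᵘ (i ℤ.+ j) 0                    ≈⟨ ℚᵘ.*≡* (cong (ℤ._* ℤ.+ 1) (sym (cong₂ ℤ._+_ (ℤ.*-identityʳ i) (ℤ.*-identityʳ j)))) ⟩
  ℚᵘ.mkℚᵘ i 0 ℚᵘ.+ ℚᵘ.mkℚᵘ j 0           ≈⟨ ℚᵘ.+-cong (ℚ.toℚᵘ-fromℚᵘ (ℚᵘ.mkℚᵘ i 0)) (ℚ.toℚᵘ-fromℚᵘ (ℚᵘ.mkℚᵘ j 0)) ⟨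
  ℚ.toℚᵘ (i / 1) ℚᵘ.+ ℚ.toℚᵘ (j / 1)     ≈⟨ ℚ.toℚᵘ-homo-+ (i / 1) (j / 1) ⟨
  ℚ.toℚᵘ (i / 1 + j / 1)                 ∎)
  where open ℚᵘ.≃-Reasoning
        import Data.Integer.Properties as ℤ

-- Evaluation of linear forms

-- The sum stops with the vector, so variables beyond the n-th, which a refutation may use, are read
-- as 0.
dot : ∀ {n} → (ℕ → ℚ) → Vec ℚ n → ℚ
dot h []       = 0ℚ
dot h (x ∷ xs) = h 0 * x + dot (h ∘ suc) xs

dot-cong : ∀ {n h k} → (∀ {i} → i < n → h i ≡ k i) → (x : Vec ℚ n) → dot h x ≡ dot k x
dot-cong eq []       = refl
dot-cong eq (x ∷ xs) = cong₂ _+_ (cong (_* x) (eq (s≤s z≤n))) (dot-cong (eq ∘ s≤s) xs)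

dot-zero : ∀ {n} (x : Vec ℚ n) → dot (λ _ → 0ℚ) x ≡ 0ℚ
dot-zero []       = refl
dot-zero (x ∷ xs) = trans (cong₂ _+_ (ℚ.*-zeroˡ x) (dot-zero xs)) (ℚ.+-identityˡ 0ℚ)

dot-combine : ∀ {n} α β h k (x : Vec ℚ n) →
  dot (λ i → α * h i + β * k i) x ≡ α * dot h x + β * dot k x
dot-combine α β h k [] = solve 2 (λ α β → con 0ℚ := α :* con 0ℚ :+ β :* con 0ℚ) refl α β
  where open ℚ.+-*-Solver
dot-combine α β h k (x ∷ xs) =
  trans (cong (λ z → (α * h 0 + β * k 0) * x + z) (dot-combine α β (h ∘ suc) (k ∘ suc) xs))
    (solve 7 (λ α β h₀ k₀ x H K →
      (α :* h₀ :+ β :* k₀) :* x :+ (α :* H :+ β :* K) := α :* (h₀ :* x :+ H) :+ β :* (k₀ :* x :+ K))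
      refl α β (h 0) (k 0) x (dot (h ∘ suc) xs) (dot (k ∘ suc) xs))
  where open ℚ.+-*-Solver

dot-zipWith-+ : ∀ {n} h (x y : Vec ℚ n) → dot h (zipWith _+_ x y) ≡ dot h x + dot h y
dot-zipWith-+ h [] [] = refl
dot-zipWith-+ h (x ∷ xs) (y ∷ ys) =
  trans (cong (λ z → h 0 * (x + y) + z) (dot-zipWith-+ (h ∘ suc) xs ys))
    (solve 5 (λ h₀ x y X Y → h₀ :* (x :+ y) :+ (X :+ Y) := (h₀ :* x :+ X) :+ (h₀ :* y :+ Y))
      refl (h 0) x y (dot (h ∘ suc) xs) (dot (h ∘ suc) ys))
  where open ℚ.+-*-Solver

≈ᶠ-refl : ∀ g → g ≈ᶠ g
≈ᶠ-refl g = refl , λ _ → refl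

≈ᶠ-sym : ∀ g h → g ≈ᶠ h → h ≈ᶠ g
≈ᶠ-sym g h (c , cs) = sym c , sym ∘ cs

coeff-lincomb : ∀ α β as bs i → coeff (lincomb α β as bs) i ≡ α * coeff as i + β * coeff bs i
coeff-lincomb α β [] [] i = solve 2 (λ α β → con 0ℚ := α :* con 0ℚ :+ β :* con 0ℚ) refl α β
  where open ℚ.+-*-Solver
coeff-lincomb α β (a ∷ as) [] zero = solve 3 (λ α β a → α :* a := α :* a :+ β :* con 0ℚ) refl α β a
  where open ℚ.+-*-Solver
coeff-lincomb α β (a ∷ as) [] (suc i) = coeff-lincomb α β as [] i
coeff-lincomb α β [] (b ∷ bs) zero = solve 3 (λ α β b → β :* b := α :* con 0ℚ :+ β :* b) refl α β b
  where open ℚ.+-*-Solver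
coeff-lincomb α β [] (b ∷ bs) (suc i) = coeff-lincomb α β [] bs i
coeff-lincomb α β (a ∷ as) (b ∷ bs) zero = refl
coeff-lincomb α β (a ∷ as) (b ∷ bs) (suc i) = coeff-lincomb α β as bs i

-- Opaque because _+_ and _*_ on ℚ unfold even on variables (by eta for the
-- record ℚ), which makes unification of evaluated forms explode.
opaque
  _⊕_ : ∀ {n} → Vec ℚ n → Vec ℚ n → Vec ℚ n
  _⊕_ = zipWith _+_

  eval : ∀ {n} → LinForm → Vec ℚ n → ℚ
  eval g x = const g + dot (coeff (coeffs g)) x

  eval-resp-≈ᶠ : ∀ {n g h} → g ≈ᶠ h → (x : Vec ℚ n) → eval g x ≡ eval h x
  eval-resp-≈ᶠ (c , cs) x = cong₂ _+_ c (dot-cong (λ {i} _ → cs i) x)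

  eval-combine : ∀ {n} α β f g (x : Vec ℚ n) → eval (combine α β f g) x ≡ α * eval f x + β * eval g x
  eval-combine α β f g x =
    trans (cong (λ z → α * const f + β * const g + z)
        (trans (dot-cong (λ {i} _ → coeff-lincomb α β (coeffs f) (coeffs g) i) x)
          (dot-combine α β (coeff (coeffs f)) (coeff (coeffs g)) x)))
      (solve 6 (λ α β c d F G → (α :* c :+ β :* d) :+ (α :* F :+ β :* G) := α :* (c :+ F) :+ β :* (d :+ G))
        refl α β (const f) (const g) (dot (coeff (coeffs f)) x) (dot (coeff (coeffs g)) x))
    where open ℚ.+-*-Solver

  -- An affine form sums over a pair to twice its constant plus its linear part at the vector sum,
  -- so only that sum matters.
  eval-⊕ : ∀ {n} g {x y x′ y′ : Vec ℚ n} → x ⊕ y ≡ x′ ⊕ y′ →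
    eval g x + eval g y ≡ eval g x′ + eval g y′
  eval-⊕ {n} g {x} {y} {x′} {y′} eq = trans (expand x y)
    (trans (cong (λ z → const g + const g + dot (coeff (coeffs g)) z) eq) (sym (expand x′ y′)))
    where
    open ℚ.+-*-Solver
    expand : ∀ (x y : Vec ℚ n) → eval g x + eval g y ≡ const g + const g + dot (coeff (coeffs g)) (x ⊕ y)
    expand x y = trans
      (solve 3 (λ c X Y → (c :+ X) :+ (c :+ Y) := c :+ c :+ (X :+ Y)) refl
        (const g) (dot (coeff (coeffs g)) x) (dot (coeff (coeffs g)) y))
      (cong (λ z → const g + const g + z) (sym (dot-zipWith-+ (coeff (coeffs g)) x y)))

  eval-constant : ∀ {n} g → (∀ i → coeff (coeffs g) i ≡ 0ℚ) → (x : Vec ℚ n) → eval g x ≡ const g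
  eval-constant g cs x =
    trans (cong (const g +_) (trans (dot-cong (λ {i} _ → cs i) x) (dot-zero x))) (ℚ.+-identityʳ (const g))

-- Forms and clauses of size zero

coeffSize≡0 : ∀ q → coeffSize q ≡ 0 → q ≡ 0ℚ
coeffSize≡0 q eq with q ℚ.≟ 0ℚ
... | yes q≡0 = q≡0

constSize≡0 : ∀ q → constSize q ≡ 0 → q ≡ 0ℚ
constSize≡0 q eq with q ℚ.≟ 0ℚ
... | yes q≡0 = q≡0
-- The denominator alone has at least one bit.
... | no _ with () ← ℕ.m+n≡0⇒n≡0 (bitLen ℤ.∣ ℚ.↥ q ∣) eq

formSize≡0 : ∀ {n} g → formSize g ≡ 0 → (x : Vec ℚ n) → eval g x ≡ 0ℚ
formSize≡0 g eq x =
  trans (eval-constant g (coeffs≡0 (coeffs g) (ℕ.m+n≡0⇒n≡0 (constSize (const g)) eq)) x)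
    (constSize≡0 (const g) (ℕ.m+n≡0⇒m≡0 (constSize (const g)) eq))
  where
  coeffs≡0 : ∀ qs → sumℕ (map coeffSize qs) ≡ 0 → ∀ i → coeff qs i ≡ 0ℚ
  coeffs≡0 [] _ i = refl
  coeffs≡0 (q ∷ qs) eq zero = coeffSize≡0 q (ℕ.m+n≡0⇒m≡0 (coeffSize q) eq)
  coeffs≡0 (q ∷ qs) eq (suc i) = coeffs≡0 qs (ℕ.m+n≡0⇒n≡0 (coeffSize q) eq) i

clauseSize≡0 : ∀ C → clauseSize C ≡ 0 → ∀ {g} → g ∈ C → formSize g ≡ 0
clauseSize≡0 (g ∷ C) eq (here refl) = ℕ.m+n≡0⇒m≡0 (formSize g) eq
clauseSize≡0 (g ∷ C) eq (there p)   = clauseSize≡0 C (ℕ.m+n≡0⇒n≡0 (formSize g) eq) p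

-- The boolean cube

cube : (n : ℕ) → List (Vec ℚ n)
cube = words (0ℚ ∷ 1ℚ ∷ [])

cube-unique : ∀ n → Unique (cube n)
cube-unique = words-unique (((λ ()) ∷ []) ∷ [] ∷ [])

opaque
  unfolding _⊕_

  ⊕-cube : ∀ {n} {x y : Vec ℚ n} → x ∈ cube n → y ∈ cube n → x ⊕ y ∈ words (0ℚ ∷ 1ℚ ∷ (1ℚ + 1ℚ) ∷ []) n
  ⊕-cube = zipWith-words λ where
    (here refl) (here refl) → here refl
    (here refl) (there (here refl)) → there (here refl)
    (there (here refl)) (here refl) → there (here refl)
    (there (here refl)) (there (here refl)) → there (there (here refl))

unit : ℕ → List ℚ
unit zero    = 1ℚ ∷ []
unit (suc k) = 0ℚ ∷ unit k

-- The local function in the definition of varForm has no name in scope; the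
-- underscore is solved to it, in the with-clause where its two arguments
-- have become distinct variables.
mutual
  varFormCoeffs : ℕ → ℕ → List ℚ
  varFormCoeffs = _

  coeffs-varForm-suc : ∀ k → coeffs (varForm (suc k)) ≡ 0ℚ ∷ unit k
  coeffs-varForm-suc k with suc k
  ... | m = cong (0ℚ ∷_) (varFormCoeffs≡unit m k)

  varFormCoeffs≡unit : ∀ i k → varFormCoeffs i k ≡ unit k
  varFormCoeffs≡unit i zero    = refl
  varFormCoeffs≡unit i (suc k) = cong (0ℚ ∷_) (varFormCoeffs≡unit i k)

coeffs-varForm : ∀ k → coeffs (varForm k) ≡ unit k
coeffs-varForm zero    = refl
coeffs-varForm (suc k) = coeffs-varForm-suc k

dot-unit : ∀ {n} k {x : Vec ℚ n} → x ∈ cube n → dot (coeff (unit k)) x ∈ 0ℚ ∷ 1ℚ ∷ []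
-- The variable lies beyond the end of the vector and counts as 0.
dot-unit k {[]} _ = here refl
dot-unit zero {x ∷ xs} p = subst (_∈ 0ℚ ∷ 1ℚ ∷ [])
  (sym (trans (cong₂ _+_ (ℚ.*-identityˡ x) (dot-zero xs)) (ℚ.+-identityʳ x))) (proj₁ (∈-words⁻ p))
dot-unit (suc k) {x ∷ xs} p = subst (_∈ 0ℚ ∷ 1ℚ ∷ [])
  (sym (trans (cong (_+ dot (coeff (unit k)) xs) (ℚ.*-zeroˡ x)) (ℚ.+-identityˡ _)))
  (dot-unit k (proj₂ (∈-words⁻ p)))

dot-varForm : ∀ {n} k {x : Vec ℚ n} → x ∈ cube n → dot (coeff (coeffs (varForm k))) x ∈ 0ℚ ∷ 1ℚ ∷ []
dot-varForm k {x} p = subst (λ cs → dot (coeff cs) x ∈ 0ℚ ∷ 1ℚ ∷ []) (sym (coeffs-varForm k)) (dot-unit k p)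

*-bit-≥0 : ∀ {h x} → 0ℚ ℚ.≤ h → x ∈ 0ℚ ∷ 1ℚ ∷ [] → 0ℚ ℚ.≤ h * x
*-bit-≥0 {h} _   (here refl)         = ℚ.≤-reflexive (sym (ℚ.*-zeroʳ h))
*-bit-≥0 {h} h≥0 (there (here refl)) = ℚ.≤-trans h≥0 (ℚ.≤-reflexive (sym (ℚ.*-identityʳ h)))

*-bit-≤ : ∀ {h x} → 0ℚ ℚ.≤ h → x ∈ 0ℚ ∷ 1ℚ ∷ [] → h * x ℚ.≤ h
*-bit-≤ {h} h≥0 (here refl)         = ℚ.≤-trans (ℚ.≤-reflexive (ℚ.*-zeroʳ h)) h≥0
*-bit-≤ {h} _   (there (here refl)) = ℚ.≤-reflexive (ℚ.*-identityʳ h)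

dot-≥0 : ∀ {n h} → (∀ i → 0ℚ ℚ.≤ h i) → {x : Vec ℚ n} → x ∈ cube n → 0ℚ ℚ.≤ dot h x
dot-≥0 h≥0 {[]} _ = ℚ.≤-refl
dot-≥0 h≥0 {x ∷ xs} p =
  ℚ.+-mono-≤ (*-bit-≥0 (h≥0 0) (proj₁ (∈-words⁻ p))) (dot-≥0 (h≥0 ∘ suc) (proj₂ (∈-words⁻ p)))

-- The gap h 0 is what makes the induction work: a difference of at least
-- h 1 = 2 h 0 in the tail survives a change of the first bit.
dot-gap : ∀ {n h} → (∀ i → 0ℚ ℚ.≤ h i) → (∀ i → h (suc i) ≡ h i + h i) →
  {x y : Vec ℚ n} → x ∈ cube n → y ∈ cube n →
  x ≡ y ⊎ dot h x + h 0 ℚ.≤ dot h y ⊎ dot h y + h 0 ℚ.≤ dot h x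
dot-gap _ _ {[]} {[]} _ _ = inj₁ refl
dot-gap {h = h} h≥0 dbl {x ∷ xs} {y ∷ ys} p q
  with dot-gap (h≥0 ∘ suc) (dbl ∘ suc) (proj₂ (∈-words⁻ p)) (proj₂ (∈-words⁻ q))
... | inj₁ refl = first-bit (proj₁ (∈-words⁻ p)) (proj₁ (∈-words⁻ q))
  where
  open ℚ.+-*-Solver
  step : ∀ T → h 0 * 0ℚ + T + h 0 ≡ h 0 * 1ℚ + T
  step T = solve 2 (λ h T → h :* con 0ℚ :+ T :+ h := h :* con 1ℚ :+ T) refl (h 0) T
  first-bit : ∀ {x y} → x ∈ 0ℚ ∷ 1ℚ ∷ [] → y ∈ 0ℚ ∷ 1ℚ ∷ [] →
    x ∷ xs ≡ y ∷ xs ⊎ dot h (x ∷ xs) + h 0 ℚ.≤ dot h (y ∷ xs) ⊎ dot h (y ∷ xs) + h 0 ℚ.≤ dot h (x ∷ xs)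
  first-bit (here refl)         (here refl)         = inj₁ refl
  first-bit (here refl)         (there (here refl)) = inj₂ (inj₁ (ℚ.≤-reflexive (step _)))
  first-bit (there (here refl)) (here refl)         = inj₂ (inj₂ (ℚ.≤-reflexive (step _)))
  first-bit (there (here refl)) (there (here refl)) = inj₁ refl
... | inj₂ far = inj₂ ([ (λ le → inj₁ (step (proj₁ (∈-words⁻ p)) (proj₁ (∈-words⁻ q)) le))
                       , (λ le → inj₂ (step (proj₁ (∈-words⁻ q)) (proj₁ (∈-words⁻ p)) le)) ]′ far)
  where
  open ℚ.≤-Reasoning
  step : ∀ {x y X Y} → x ∈ 0ℚ ∷ 1ℚ ∷ [] → y ∈ 0ℚ ∷ 1ℚ ∷ [] → X + h 1 ℚ.≤ Y → h 0 * x + X + h 0 ℚ.≤ h 0 * y + Y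
  step {x} {y} {X} {Y} x∈ y∈ le = begin
    h 0 * x + X + h 0    ≤⟨ ℚ.+-monoˡ-≤ (h 0) (ℚ.+-monoˡ-≤ X (*-bit-≤ (h≥0 0) x∈)) ⟩
    h 0 + X + h 0        ≡⟨ solve 2 (λ h X → h :+ X :+ h := con 0ℚ :+ (X :+ (h :+ h))) refl (h 0) X ⟩
    0ℚ + (X + (h 0 + h 0)) ≡⟨ cong (λ t → 0ℚ + (X + t)) (sym (dbl 0)) ⟩
    0ℚ + (X + h 1)       ≤⟨ ℚ.+-mono-≤ (*-bit-≥0 (h≥0 0) y∈) le ⟩
    h 0 * y + Y          ∎
    where open ℚ.+-*-Solver

-- Values of `fₙ` and of boolean literals on the cube

coeff-applyUpTo : ∀ h {n i} → i < n → coeff (applyUpTo h n) i ≡ h i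
coeff-applyUpTo h {suc n} {zero}  _       = refl
coeff-applyUpTo h {suc n} {suc i} (s≤s p) = coeff-applyUpTo (h ∘ suc) p

opaque
  unfolding eval

  weight : ℕ → ℚ
  weight i = (ℤ.+ (2 ^ suc i)) / 1

  weight-≥0 : ∀ i → 0ℚ ℚ.≤ weight i
  weight-≥0 i = ℚ.nonNegative⁻¹ (weight i) {{ℚ.normalize-nonNeg (2 ^ suc i) 1}}

  weight-double : ∀ i → weight (suc i) ≡ weight i + weight i
  weight-double i = trans (cong (λ k → (ℤ.+ k) / 1) (cong (2 ^ suc i ℕ.+_) (ℕ.+-identityʳ (2 ^ suc i))))
    (/1-homo-+ (ℤ.+ (2 ^ suc i)) (ℤ.+ (2 ^ suc i)))

  weight-pos : 0ℚ ℚ.< weight 0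
  weight-pos = ℚ.positive⁻¹ (weight 0)

  eval-fₙ : ∀ {n} (x : Vec ℚ n) → eval (fₙ n) x ≡ 1ℚ + dot weight x
  eval-fₙ {n} x = cong (1ℚ +_) (dot-cong
    (λ {i} i<n → trans (cong (λ cs → coeff cs i) (List.map-upTo weight n)) (coeff-applyUpTo weight i<n)) x)

  eval-varForm : ∀ {n} k {x : Vec ℚ n} → x ∈ cube n → eval (varForm k) x ∈ 0ℚ ∷ 1ℚ ∷ []
  eval-varForm k {x} p = subst (_∈ 0ℚ ∷ 1ℚ ∷ []) (sym (ℚ.+-identityˡ (dot (coeff (coeffs (varForm k))) x))) (dot-varForm k p)

  eval-varMinusOne : ∀ {n} k (x : Vec ℚ n) → eval (varMinusOne k) x ≡ - 1ℚ + eval (varForm k) x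
  eval-varMinusOne k x = cong (- 1ℚ +_) (sym (ℚ.+-identityˡ (dot (coeff (coeffs (varForm k))) x)))

-- All weights are nonnegative, so the constant term 1 bounds the values from below.
fₙ-nonzero : ∀ {n} {x : Vec ℚ n} → x ∈ cube n → eval (fₙ n) x ≢ 0ℚ
fₙ-nonzero {x = x} p eq = ℚ.<⇒≢
  (ℚ.<-≤-trans (ℚ.positive⁻¹ 1ℚ) (ℚ.≤-trans (ℚ.≤-reflexive (sym (ℚ.+-identityʳ 1ℚ)))
    (ℚ.+-mono-≤ (ℚ.≤-refl {1ℚ}) (dot-≥0 weight-≥0 p))))
  (sym (trans (sym (eval-fₙ x)) eq))

-- By `dot-gap`, distinct points have values at least `weight 0` > 0 apart.
fₙ-injective : ∀ {n} {x y : Vec ℚ n} → x ∈ cube n → y ∈ cube n → eval (fₙ n) x ≡ eval (fₙ n) y → x ≡ y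
fₙ-injective {x = x} {y} p q eq with dot-gap weight-≥0 weight-double p q
... | inj₁ x≡y = x≡y
... | inj₂ far = ⊥-elim ([ apart dots , apart (sym dots) ]′ far)
  where
  dots : dot weight x ≡ dot weight y
  dots = +-cancelˡ 1ℚ _ _ (trans (sym (eval-fₙ x)) (trans eq (eval-fₙ y)))
  apart : ∀ {s t} → s ≡ t → ¬ (s + weight 0 ℚ.≤ t)
  apart {s} refl le = ℚ.<-irrefl refl (ℚ.<-≤-trans (subst (ℚ._< s + weight 0) (ℚ.+-identityʳ s)
    (ℚ.+-mono-≤-< (ℚ.≤-refl {s}) weight-pos)) le)

-- Points where a form is a given multiple of fₙ

opaque
  Agree : ∀ {n} → LinForm → ℚ → Vec ℚ n → Set
  Agree {n} g β x = eval g x ≡ β * eval (fₙ n) x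

  agree? : ∀ {n} g β (x : Vec ℚ n) → Dec (Agree g β x)
  agree? {n} g β x = eval g x ℚ.≟ β * eval (fₙ n) x

  agree-resp-≈ᶠ : ∀ {n g h β} {x : Vec ℚ n} → g ≈ᶠ h → Agree g β x → Agree h β x
  agree-resp-≈ᶠ {g = g} {h} {x = x} g≈h eq = trans (sym (eval-resp-≈ᶠ {g = g} {h} g≈h x)) eq

  -- `fₙ` can be cancelled since it has no zero on the cube. With `agree-∃`, the agreement sets of a
  -- form partition the cube.
  agree-unique : ∀ {n g β γ} {x : Vec ℚ n} → x ∈ cube n → Agree g β x → Agree g γ x → β ≡ γ
  agree-unique {n} {x = x} x∈ p q = *-cancelʳ (eval (fₙ n) x) (fₙ-nonzero x∈) (trans (sym p) q)

  agree-∃ : ∀ {n} g {x : Vec ℚ n} → x ∈ cube n → ∃[ β ] Agree g β x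
  agree-∃ {n} g {x} x∈ = eval g x * ℚ.1/ eval (fₙ n) x ,
    sym (trans (ℚ.*-assoc (eval g x) (ℚ.1/ eval (fₙ n) x) (eval (fₙ n) x))
      (trans (cong (eval g x *_) (ℚ.*-inverseˡ (eval (fₙ n) x))) (ℚ.*-identityʳ (eval g x))))
    where
    instance
      fx≢0 : ℚ.NonZero (eval (fₙ n) x)
      fx≢0 = ℚ.≢-nonZero (fₙ-nonzero x∈)

  agree-fₙ : ∀ {n} (x : Vec ℚ n) → Agree (fₙ n) 1ℚ x
  agree-fₙ {n} x = sym (ℚ.*-identityˡ (eval (fₙ n) x))

  agree-0⁺ : ∀ {n g} {x : Vec ℚ n} → eval g x ≡ 0ℚ → Agree g 0ℚ x
  agree-0⁺ {n} {x = x} eq = trans eq (sym (ℚ.*-zeroˡ (eval (fₙ n) x)))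

  agree-0⁻ : ∀ {n g} {x : Vec ℚ n} → Agree g 0ℚ x → eval g x ≡ 0ℚ
  agree-0⁻ {n} {x = x} eq = trans eq (ℚ.*-zeroˡ (eval (fₙ n) x))

  agree-combine : ∀ {n} α β g h {ρ σ} {x : Vec ℚ n} → Agree g ρ x → Agree h σ x →
    Agree (combine α β g h) (α * ρ + β * σ) x
  agree-combine {n} α β g h {ρ} {σ} {x} p q = begin
    eval (combine α β g h) x                              ≡⟨ eval-combine α β g h x ⟩
    α * eval g x + β * eval h x                           ≡⟨ cong₂ (λ s t → α * s + β * t) p q ⟩
    α * (ρ * eval (fₙ n) x) + β * (σ * eval (fₙ n) x)     ≡⟨ solve 5 (λ α β ρ σ F →
                                                               α :* (ρ :* F) :+ β :* (σ :* F) := (α :* ρ :+ β :* σ) :* F)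
                                                               refl α β ρ σ (eval (fₙ n) x) ⟩
    (α * ρ + β * σ) * eval (fₙ n) x                       ∎
    where
    open ≡-Reasoning
    open ℚ.+-*-Solver

  -- For γ ≠ 0 a form with values 0 and v can equal γ fₙ only where fₙ = v / γ.
  agree-two-valued : ∀ {n g v γ} {x y : Vec ℚ n} → x ∈ cube n → y ∈ cube n → γ ≢ 0ℚ →
    eval g x ∈ 0ℚ ∷ v ∷ [] → eval g y ∈ 0ℚ ∷ v ∷ [] → Agree g γ x → Agree g γ y → x ≡ y
  agree-two-valued {n} {g} {v} {γ} {x} {y} x∈ y∈ γ≢0 gx gy px py =
    fₙ-injective x∈ y∈ (*-cancelʳ γ γ≢0 (trans (value x∈ gx px) (sym (value y∈ gy py))))
    where
    value : ∀ {z} → z ∈ cube n → eval g z ∈ 0ℚ ∷ v ∷ [] → Agree g γ z → eval (fₙ n) z * γ ≡ v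
    value z∈ (here g≡0) p = contradiction (agree-unique {g = g} z∈ p (agree-0⁺ {g = g} g≡0)) γ≢0
    value {z} z∈ (there (here g≡v)) p = trans (ℚ.*-comm (eval (fₙ n) z) γ) (trans (sym p) g≡v)

  agree-⊕-injective : ∀ {n g β γ} {x y x′ y′ : Vec ℚ n} → β ≢ γ →
    x ∈ cube n → y ∈ cube n → x′ ∈ cube n → y′ ∈ cube n →
    Agree g β x → Agree g γ y → Agree g β x′ → Agree g γ y′ → x ⊕ y ≡ x′ ⊕ y′ → x ≡ x′ × y ≡ y′
  agree-⊕-injective {n} {g} {β} {γ} {x} {y} {x′} {y′} β≢γ x∈ y∈ x′∈ y′∈ px py px′ py′ eq =
    fₙ-injective x∈ x′∈ fx≡fx′ , fₙ-injective y∈ y′∈ fy≡fy′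
    where
    fsum : eval (fₙ n) x + eval (fₙ n) y ≡ eval (fₙ n) x′ + eval (fₙ n) y′
    fsum = eval-⊕ (fₙ n) {x} {y} {x′} {y′} eq
    gsum : β * eval (fₙ n) x + γ * eval (fₙ n) y ≡ β * eval (fₙ n) x′ + γ * eval (fₙ n) y′
    gsum = subst₂ _≡_ (cong₂ _+_ px py) (cong₂ _+_ px′ py′) (eval-⊕ g {x} {y} {x′} {y′} eq)
    fx≡fx′ : eval (fₙ n) x ≡ eval (fₙ n) x′
    fx≡fx′ = two-weight-cancel {β} {γ} {eval (fₙ n) x} {eval (fₙ n) y} {eval (fₙ n) x′} {eval (fₙ n) y′}
      β≢γ gsum fsum
    fy≡fy′ : eval (fₙ n) y ≡ eval (fₙ n) y′
    fy≡fy′ = +-cancelˡ (eval (fₙ n) x) (eval (fₙ n) y) (eval (fₙ n) y′)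
      (trans fsum (cong (_+ eval (fₙ n) y′) (sym fx≡fx′)))

hits : ∀ n → LinForm → ℚ → List (Vec ℚ n)
hits n g β = filter (agree? g β) (cube n)

module _ {n : ℕ} where

  hits-unique : ∀ g β → Unique (hits n g β)
  hits-unique g β = Unique.filter⁺ (agree? g β) (cube-unique n)

  ∈-hits⁻ : ∀ g β {x} → x ∈ hits n g β → x ∈ cube n × Agree g β x
  ∈-hits⁻ g β = ∈-filter⁻ (agree? g β)

  ∈-hits⁺ : ∀ g β {x} → x ∈ cube n → Agree g β x → x ∈ hits n g β
  ∈-hits⁺ g β = ∈-filter⁺ (agree? g β)

  hits-resp-≈ᶠ : ∀ {g h} → g ≈ᶠ h → ∀ β → hits n g β ≡ hits n h β
  hits-resp-≈ᶠ {g} {h} g≈h β = List.filter-≐ (agree? g β) (agree? h β)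
    (agree-resp-≈ᶠ {g = g} {h} g≈h , agree-resp-≈ᶠ {g = h} {g} (≈ᶠ-sym g h g≈h)) (cube n)

  -- The base 3 counts the possible entries 0, 1, 2 of a sum of two bit vectors.
  hits-*-hits : ∀ g {β γ} → β ≢ γ → length (hits n g β) ℕ.* length (hits n g γ) ≤ 3 ^ n
  hits-*-hits g {β} {γ} β≢γ = begin
    length (hits n g β) ℕ.* length (hits n g γ)        ≡⟨ length-cartesianProductWith _,_ (hits n g β) (hits n g γ) ⟨
    length (cartesianProduct (hits n g β) (hits n g γ)) ≤⟨ length-injective-on (uncurry (_⊕_))
                                                           (Unique.cartesianProduct⁺ (hits-unique g β) (hits-unique g γ)) inj into ⟩
    length (words (0ℚ ∷ 1ℚ ∷ (1ℚ + 1ℚ) ∷ []) n)        ≡⟨ length-words (0ℚ ∷ 1ℚ ∷ (1ℚ + 1ℚ) ∷ []) n ⟩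
    3 ^ n                                              ∎
    where
    open ℕ.≤-Reasoning
    pairs = cartesianProduct (hits n g β) (hits n g γ)
    split : ∀ {x y} → (x , y) ∈ pairs → x ∈ hits n g β × y ∈ hits n g γ
    split = ∈-cartesianProduct⁻ (hits n g β) (hits n g γ)
    into : ∀ {p} → p ∈ pairs → uncurry (_⊕_) p ∈ words (0ℚ ∷ 1ℚ ∷ (1ℚ + 1ℚ) ∷ []) n
    into p∈ with split p∈
    ... | x∈ , y∈ = ⊕-cube (proj₁ (∈-hits⁻ g β x∈)) (proj₁ (∈-hits⁻ g γ y∈))
    inj : ∀ {p q} → p ∈ pairs → q ∈ pairs → uncurry _⊕_ p ≡ uncurry _⊕_ q → p ≡ q
    inj {x , y} {x′ , y′} p∈ q∈ eq with split p∈ | split q∈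
    ... | px , py | qx , qy with ∈-hits⁻ g β px | ∈-hits⁻ g γ py | ∈-hits⁻ g β qx | ∈-hits⁻ g γ qy
    ... | x∈ , ax | y∈ , ay | x′∈ , ax′ | y′∈ , ay′ =
      ×-≡,≡→≡ (agree-⊕-injective {g = g} β≢γ x∈ y∈ x′∈ y′∈ ax ay ax′ ay′ eq)

-- The lossy invariant

module _ {n m : ℕ} (1≤n : 1 ≤ n) (m²≤ : m ℕ.* m ≤ 3 ^ n) (<[1+m]² : 3 ^ n < suc m ℕ.* suc m) where

  Rare : LinForm → ℚ → Set
  Rare g β = length (hits n g β) ≤ m

  -- Characterises the ratio independently of how it is found; the alternative β ≡ 0 is the default
  -- for a form all of whose scalars are rare.
  DominantOr0 : LinForm → ℚ → Set
  DominantOr0 g β = (β ≡ 0ℚ ⊎ ¬ Rare g β) × (∀ γ → γ ≢ β → Rare g γ)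

  1≤m : 1 ≤ m
  1≤m = ℕ.n≢0⇒n>0 λ { refl → ℕ.<⇒≱ <[1+m]² (ℕ.m^n>0 3 n) }

  -- Otherwise 4^n ≤ m² ≤ 3^n, impossible for n ≥ 1. This makes the whole cube too large to be rare.
  m<2^n : m < 2 ^ n
  m<2^n = ℕ.≰⇒> λ 2^n≤m → ℕ.<⇒≱ (ℕ.^-monoˡ-< n {{ℕ.>-nonZero 1≤n}} {3} {4} ℕ.≤-refl) (begin
    4 ^ n                ≡⟨ ℕ.^-*-assoc 2 2 n ⟩
    2 ^ (2 ℕ.* n)        ≡⟨ cong (λ k → 2 ^ (n ℕ.+ k)) (ℕ.+-identityʳ n) ⟩
    2 ^ (n ℕ.+ n)        ≡⟨ ℕ.^-distribˡ-+-* 2 n n ⟩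
    2 ^ n ℕ.* 2 ^ n      ≤⟨ ℕ.*-mono-≤ 2^n≤m 2^n≤m ⟩
    m ℕ.* m              ≤⟨ m²≤ ⟩
    3 ^ n                ∎)
    where open ℕ.≤-Reasoning

  -- Two sets of more than `m` points would have sizes with product at least (m+1)² > 3^n, against
  -- `hits-*-hits`.
  rare-unless-dominant : ∀ g {β γ} → ¬ Rare g β → γ ≢ β → Rare g γ
  rare-unless-dominant g {β} {γ} β-many γ≢β with length (hits n g γ) ℕ.≤? m
  ... | yes γ-few  = γ-few
  ... | no  γ-many = contradiction
    (ℕ.≤-trans (ℕ.*-mono-≤ (ℕ.≰⇒> γ-many) (ℕ.≰⇒> β-many)) (hits-*-hits {n} g γ≢β)) (ℕ.<⇒≱ <[1+m]²)

  -- Makes the search for a dominant scalar finite: only scalars realised at some point have to be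
  -- tested.
  candidates : ∀ g (xs : List (Vec ℚ n)) → (∀ {x} → x ∈ xs → x ∈ cube n) →
    ∃[ βs ] (∀ {x} → x ∈ xs → Any (λ β → Agree g β x) βs)
  candidates g []       _   = [] , λ ()
  candidates g (x ∷ xs) sub with agree-∃ g (sub (here refl)) | candidates g xs (sub ∘ there)
  ... | β , eq | βs , found = β ∷ βs , λ { (here refl) → here eq ; (there p) → there (found p) }

  dominant : ∀ g → ∃ (DominantOr0 g)
  dominant g with candidates g (cube n) id
  ... | βs , found with Any.any? (λ β → ¬? (length (hits n g β) ℕ.≤? m)) βs
  ... | yes p with find p
  ...   | β , _ , β-many = β , inj₂ β-many , λ γ γ≢β → rare-unless-dominant g β-many γ≢β
  dominant g | βs , found | no none = 0ℚ , inj₁ refl , λ γ _ → all-rare γ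
    where
    all-rare : ∀ γ → Rare g γ
    all-rare γ with length (hits n g γ) ℕ.≤? m
    ... | yes γ-few  = γ-few
    -- A scalar that is not rare has a point, and a scalar listed for that point must equal it, so
    -- the search would have succeeded.
    ... | no  γ-many with nonempty (ℕ.≤-trans (s≤s z≤n) (ℕ.≰⇒> γ-many))
    ...   | x , x∈hits with ∈-hits⁻ g γ x∈hits
    ...     | x∈ , eq = contradiction
      (Any.map (λ eq′ β-few → γ-many (subst (Rare g) (agree-unique {g = g} x∈ eq′ eq) β-few)) (found x∈))
      none

  ratio : LinForm → ℚ
  ratio g = proj₁ (dominant g)

  Rare-resp-≈ᶠ : ∀ {g h} → g ≈ᶠ h → ∀ {β} → Rare g β → Rare h β
  Rare-resp-≈ᶠ {g} {h} g≈h {β} = subst (λ xs → length xs ≤ m) (hits-resp-≈ᶠ {n} {g} {h} g≈h β)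

  -- If the two scalars differed, each would be rare by the property of the other; then both must be
  -- the default 0.
  ratio-unique : ∀ {g β} → DominantOr0 g β → ratio g ≡ β
  ratio-unique {g} {β} (β-dom , β-rest) with dominant g
  ... | ρ , ρ-dom , ρ-rest with ρ ℚ.≟ β
  ...   | yes ρ≡β = ρ≡β
  ...   | no  ρ≢β with β-dom | ρ-dom
  ...     | inj₁ β≡0   | inj₁ ρ≡0   = trans ρ≡0 (sym β≡0)
  ...     | inj₂ β-many | _          = contradiction (ρ-rest β (≢-sym ρ≢β)) β-many
  ...     | inj₁ _     | inj₂ ρ-many = contradiction (β-rest ρ ρ≢β) ρ-many

  -- The search runs on representations, but its outcome is pinned down by the sizes of the
  -- agreement sets, which `≈ᶠ` preserves.
  ratio-resp-≈ᶠ : ∀ {g h} → g ≈ᶠ h → ratio g ≡ ratio h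
  ratio-resp-≈ᶠ {g} {h} g≈h with dominant h
  ... | ρ , dom , rest = ratio-unique
    ( map₂ (λ many few → many (Rare-resp-≈ᶠ {g} {h} g≈h few)) dom
    , λ γ γ≢ρ → Rare-resp-≈ᶠ {h} {g} (≈ᶠ-sym g h g≈h) (rest γ γ≢ρ))

  -- The scalar 1 has all 2^n > m points, every other scalar has none.
  ratio-fₙ : ratio (fₙ n) ≡ 1ℚ
  ratio-fₙ = ratio-unique (inj₂ many , few)
    where
    many : ¬ Rare (fₙ n) 1ℚ
    many few = ℕ.<⇒≱ m<2^n (ℕ.≤-trans (ℕ.≤-reflexive (sym (length-words (0ℚ ∷ 1ℚ ∷ []) n)))
      (ℕ.≤-trans (length-⊆ (cube-unique n) (λ {x} x∈ → ∈-hits⁺ (fₙ n) 1ℚ x∈ (agree-fₙ x))) few))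
    few : ∀ γ → γ ≢ 1ℚ → Rare (fₙ n) γ
    few γ γ≢1 = ℕ.≤-trans (length-⊆ {ys = []} (hits-unique (fₙ n) γ) λ {x} x∈hits →
      let x∈ , eq = ∈-hits⁻ (fₙ n) γ x∈hits
      in contradiction (agree-unique {g = fₙ n} x∈ eq (agree-fₙ x)) γ≢1) z≤n

  -- A nonzero scalar has at most one point, and 1 ≤ m makes that rare. This serves the boolean
  -- literals, the constants and the zero form.
  ratio-two-valued : ∀ {g} v → (∀ {x : Vec ℚ n} → x ∈ cube n → eval g x ∈ 0ℚ ∷ v ∷ []) → ratio g ≡ 0ℚ
  ratio-two-valued {g} v two = ratio-unique (inj₁ refl , λ γ γ≢0 → ℕ.≤-trans (length-≤1 (hits-unique g γ) (same γ γ≢0)) 1≤m)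
    where
    same : ∀ γ → γ ≢ 0ℚ → ∀ {x y} → x ∈ hits n g γ → y ∈ hits n g γ → x ≡ y
    same γ γ≢0 p q with ∈-hits⁻ g γ p | ∈-hits⁻ g γ q
    ... | x∈ , ax | y∈ , ay = agree-two-valued {g = g} x∈ y∈ γ≢0 (two x∈) (two y∈) ax ay

  Holds : Vec ℚ n → LinForm → Set
  Holds x g = Agree g (ratio g) x

  Holds-resp-≈ᶠ : ∀ {x g h} → g ≈ᶠ h → Holds x g → Holds x h
  Holds-resp-≈ᶠ {x} {g} {h} g≈h p = subst (λ ρ → Agree h ρ x) (ratio-resp-≈ᶠ {g} {h} g≈h) (agree-resp-≈ᶠ {g = g} {h} g≈h p)

  Holdsᶜ : Vec ℚ n → Clause → Set
  Holdsᶜ x = Any (Holds x)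

  Holdsᶜ-⊆ : ∀ {x C D} → (∀ g → g ∈ᶠ C → g ∈ᶠ D) → Holdsᶜ x C → Holdsᶜ x D
  Holdsᶜ-⊆ C⊆D p with find p
  ... | g , g∈C , eq = Any.map (λ {h} g≈h → Holds-resp-≈ᶠ {g = g} {h} g≈h eq)
    (C⊆D g (Any.map (λ { refl → ≈ᶠ-refl g }) g∈C))

  Holds-0 : ∀ {x g} → ratio g ≡ 0ℚ → eval g x ≡ 0ℚ → Holds x g
  Holds-0 {x} {g} ρ≡0 e≡0 = subst (λ ρ → Agree g ρ x) (sym ρ≡0) (agree-0⁺ {g = g} e≡0)

  ¬Holds-constant : ∀ {x a} → NonzeroConstant a → ¬ Holds x a
  ¬Holds-constant {x} {a} (cs , c≢0) p = c≢0 (trans (sym (eval-constant a cs x))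
    (agree-0⁻ {g = a} (subst (λ ρ → Agree a ρ x)
      (ratio-two-valued (const a) (λ {y} _ → there (here (eval-constant a cs y)))) p)))

  Holds-fₙ : ∀ x → Holds x (fₙ n)
  Holds-fₙ x = subst (λ ρ → Agree (fₙ n) ρ x) (sym ratio-fₙ) (agree-fₙ x)

  Holds-boolAxiom : ∀ i {x} → x ∈ cube n → Holdsᶜ x (boolAxiom i)
  Holds-boolAxiom i {x} x∈ with eval-varForm i x∈
  ... | here e≡0         = here (Holds-0 (ratio-two-valued 1ℚ (eval-varForm i)) e≡0)
  ... | there (here e≡1) = there (here (Holds-0 (ratio-two-valued (- 1ℚ) two)
                             (trans (eval-varMinusOne i x) (cong (- 1ℚ +_) e≡1))))
    where
    two : ∀ {y : Vec ℚ n} → y ∈ cube n → eval (varMinusOne i) y ∈ 0ℚ ∷ (- 1ℚ) ∷ []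
    two {y} y∈ with eval-varForm i y∈
    ... | here e≡0         = there (here (trans (eval-varMinusOne i y) (cong (- 1ℚ +_) e≡0)))
    ... | there (here e≡1) = here (trans (eval-varMinusOne i y) (cong (- 1ℚ +_) e≡1))

  Holds-of-size-0 : ∀ {x g} → formSize g ≡ 0 → Holds x g
  Holds-of-size-0 {x} {g} eq = Holds-0 (ratio-two-valued 0ℚ (λ {y} _ → here (formSize≡0 g eq y))) (formSize≡0 g eq x)

  -- Where both forms hold, the combination agrees with the scalar α · ratio g + β · ratio h. Either
  -- this is its own ratio and nothing is lost, or it is rare and its points are the exceptions.
  Holds-combine : ∀ α β g h → ∃[ L ] (length L ≤ m ×
    (∀ {x} → x ∈ cube n → Holds x g → Holds x h → x ∈ L ⊎ Holds x (combine α β g h)))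
  Holds-combine α β g h with α * ratio g + β * ratio h ℚ.≟ ratio (combine α β g h)
  ... | yes δ≡ρ = [] , z≤n , λ {x} _ p q →
    inj₂ (subst (λ ρ → Agree (combine α β g h) ρ x) δ≡ρ (agree-combine α β g h p q))
  ... | no  δ≢ρ = hits n (combine α β g h) (α * ratio g + β * ratio h) ,
    proj₂ (proj₂ (dominant (combine α β g h))) (α * ratio g + β * ratio h) δ≢ρ ,
    λ x∈ p q → inj₁ (∈-hits⁺ (combine α β g h) (α * ratio g + β * ratio h) x∈ (agree-combine α β g h p q))

  -- Losses along a derivation

  -- `L` collects the points lost at this step; the new clause pays for `m` of them per unit of its
  -- size.
  Step : Clause → List Clause → Set
  Step C Γ = ∃[ L ] (length L ≤ clauseSize C ℕ.* m ×
    (∀ {x} → x ∈ cube n → All (Holdsᶜ x) Γ → x ∈ L ⊎ Holdsᶜ x C))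

  sound : ∀ {C Γ} → (∀ {x} → x ∈ cube n → All (Holdsᶜ x) Γ → Holdsᶜ x C) → Step C Γ
  sound h = [] , z≤n , λ x∈ hs → inj₂ (h x∈ hs)

  step : ∀ {Γ C} → Justified (φₙ n) Γ C → Step C Γ
  step (hyp (here refl) C≈A) = sound λ {x} _ _ → Holdsᶜ-⊆ (λ g → proj₂ (C≈A g)) (here (Holds-fₙ x))
  step (bool i C≈A) = sound λ x∈ _ → Holdsᶜ-⊆ (λ g → proj₂ (C≈A g)) (Holds-boolAxiom i x∈)
  step (weakening g E∈ C≈) = sound λ _ hs → Holdsᶜ-⊆ (λ h → proj₂ (C≈ h)) (there (All.lookup hs E∈))
  step (simplification a C′ E∈ nz aC′≈E C≈C′) = sound λ _ hs →
    Holdsᶜ-⊆ (λ h → proj₂ (C≈C′ h)) (drop-constant (Holdsᶜ-⊆ (λ h → proj₂ (aC′≈E h)) (All.lookup hs E∈)))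
    where
    drop-constant : ∀ {x} → Holdsᶜ x (a ∷ C′) → Holdsᶜ x C′
    drop-constant (here p)  = contradiction p (¬Holds-constant nz)
    drop-constant (there p) = p
  step {Γ} {C} (resolution g h C₁ C₂ α β E₁∈ E₂∈ ≈E₁ ≈E₂ C≈) with clauseSize C ℕ.≟ 0
  -- A clause of size 0 cannot pay for any loss. It contains a copy of the resolvent, hence is
  -- nonempty, and its disjuncts are zero forms, which hold everywhere.
  ... | yes size≡0 = sound λ _ _ → Any.map (λ { refl → Holds-of-size-0 (clauseSize≡0 C size≡0 k∈) }) k∈
    where
    some-literal = find (proj₂ (C≈ (combine α β g h)) (here (≈ᶠ-refl (combine α β g h))))
    k∈ : proj₁ some-literal ∈ C
    k∈ = proj₁ (proj₂ some-literal)
  ... | no size≢0 with Holds-combine α β g h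
  ...   | L , L-short , combined = L ,
    ℕ.≤-trans L-short (ℕ.m≤n*m m (clauseSize C) {{ℕ.≢-nonZero size≢0}}) ,
    λ x∈ hs → map₂ (Holdsᶜ-⊆ (λ k → proj₂ (C≈ k)))
      (resolve x∈ (Holdsᶜ-⊆ (λ k → proj₂ (≈E₁ k)) (All.lookup hs E₁∈))
                  (Holdsᶜ-⊆ (λ k → proj₂ (≈E₂ k)) (All.lookup hs E₂∈)))
    where
    resolve : ∀ {x} → x ∈ cube n → Holdsᶜ x (g ∷ C₁) → Holdsᶜ x (h ∷ C₂) →
      x ∈ L ⊎ Holdsᶜ x (combine α β g h ∷ (C₁ ++ C₂))
    -- Only a point where both premises hold through the resolved disjuncts can be lost.
    resolve x∈ (here p)  (here q)  = map₂ here (combined x∈ p q)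
    resolve x∈ (there p) _         = inj₂ (there (Any.++⁺ˡ p))
    resolve x∈ (here _)  (there q) = inj₂ (there (Any.++⁺ʳ C₁ q))

  -- The exception lists are concatenated. A point outside them satisfies all earlier clauses, as
  -- `step` demands of its premises.
  derivation-holds : ∀ {Γ} → Derivation (φₙ n) Γ →
    ∃[ L ] (length L ≤ derivationSize Γ ℕ.* m × (∀ {x} → x ∈ cube n → x ∈ L ⊎ All (Holdsᶜ x) Γ))
  derivation-holds [] = [] , z≤n , λ _ → inj₂ []
  derivation-holds (_▷_ {Γ} {C} d j) with derivation-holds d | step j
  ... | L , L-short , holds | M , M-short , holds-C = M ++ L , short , λ x∈ → extend x∈ (holds x∈)
    where
    open ℕ.≤-Reasoning
    short : length (M ++ L) ≤ derivationSize (C ∷ Γ) ℕ.* m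
    short = begin
      length (M ++ L)                                     ≡⟨ List.length-++ M ⟩
      length M ℕ.+ length L                               ≤⟨ ℕ.+-mono-≤ M-short L-short ⟩
      clauseSize C ℕ.* m ℕ.+ derivationSize Γ ℕ.* m       ≡⟨ ℕ.*-distribʳ-+ m (clauseSize C) (derivationSize Γ) ⟨
      derivationSize (C ∷ Γ) ℕ.* m                        ∎
    extend : ∀ {x} → x ∈ cube n → x ∈ L ⊎ All (Holdsᶜ x) Γ → x ∈ M ++ L ⊎ All (Holdsᶜ x) (C ∷ Γ)
    extend x∈ (inj₁ x∈L) = inj₁ (∈-++⁺ʳ M x∈L)
    extend x∈ (inj₂ hs) with holds-C x∈ hs
    ... | inj₁ x∈M = inj₁ (∈-++⁺ˡ x∈M)
    ... | inj₂ hC  = inj₂ (hC ∷ hs)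

  refutation-bound : ∀ Γ → Refutation (φₙ n) Γ → 2 ^ n ≤ derivationSize ([] ∷ Γ) ℕ.* m
  refutation-bound Γ d with derivation-holds d
  ... | L , L-short , holds = ℕ.≤-trans (ℕ.≤-reflexive (sym (length-words (0ℚ ∷ 1ℚ ∷ []) n)))
    (ℕ.≤-trans (length-⊆ (cube-unique n) lost) L-short)
    where
    lost : ∀ {x} → x ∈ cube n → x ∈ L
    lost x∈ with holds x∈
    ... | inj₁ x∈L = x∈L
    -- The empty clause has no disjunct that could hold.
    ... | inj₂ (() ∷ _)

-- 4^n ≤ S² m² ≤ S² 3^n, and (4/3)³ ≥ 2.
sixth-power-bound : ∀ {n m S} → m ℕ.* m ≤ 3 ^ n → 2 ^ n ≤ S ℕ.* m → 2 ^ n ≤ S ^ 6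
sixth-power-bound {n} {m} {S} m²≤ le = ℕ.*-cancelʳ-≤ (2 ^ n) (S ^ 6) (27 ^ n) {{ℕ.m^n≢0 27 n}} (begin
  2 ^ n ℕ.* 27 ^ n             ≡⟨ ^-distribʳ-* n 2 27 ⟨
  54 ^ n                       ≤⟨ ℕ.^-monoˡ-≤ n (ℕ.m≤m+n 54 10) ⟩
  64 ^ n                       ≡⟨ ℕ.^-*-assoc 2 6 n ⟩
  2 ^ (6 ℕ.* n)                ≡⟨ cong (2 ^_) (ℕ.*-comm 6 n) ⟩
  2 ^ (n ℕ.* 6)                ≡⟨ ℕ.^-*-assoc 2 n 6 ⟨
  (2 ^ n) ^ 6                  ≤⟨ ℕ.^-monoˡ-≤ 6 le ⟩
  (S ℕ.* m) ^ 6                ≡⟨ ^-distribʳ-* 6 S m ⟩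
  S ^ 6 ℕ.* m ^ 6              ≡⟨ cong (S ^ 6 ℕ.*_) (solve 1 (λ m → m :^ 6 := (m :* m) :^ 3) refl m) ⟩
  S ^ 6 ℕ.* (m ℕ.* m) ^ 3      ≤⟨ ℕ.*-monoʳ-≤ (S ^ 6) (ℕ.^-monoˡ-≤ 3 m²≤) ⟩
  S ^ 6 ℕ.* (3 ^ n) ^ 3        ≡⟨ cong (S ^ 6 ℕ.*_) (trans (ℕ.^-*-assoc 3 n 3)
                                   (trans (cong (3 ^_) (ℕ.*-comm n 3)) (sym (ℕ.^-*-assoc 3 3 n)))) ⟩
  S ^ 6 ℕ.* 27 ^ n             ∎)
  where
  open ℕ.≤-Reasoning
  open +-*-Solver

mainTheorem1 : ∃[ k ] ∃[ N ] (∀ (n : ℕ) → N ≤ n → ∀ (Γ : List Clause) → Refutation (φₙ n) Γ → 2 ^ n ≤ derivationSize ([] ∷ Γ) ^ suc k)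
-- `suc 5` is the exponent of `sixth-power-bound`, so the size is at least 2^(n/6). The threshold is
-- 1 since `m<2^n` fails at n = 0, where m = 1.
mainTheorem1 = 5 , 1 , λ n 1≤n Γ d →
  let m , m²≤ , <[1+m]² = ∃-sqrt (3 ^ n)
  in sixth-power-bound {n} {m} {derivationSize ([] ∷ Γ)} m²≤ (refutation-bound {n} {m} 1≤n m²≤ <[1+m]² Γ d)
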